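{- Let $\Sigma_1=(G_1,\sigma_1)$ and $\Sigma_2=(G_2,\sigma_2)$ be two finite, simple, connected signed graphs and let $\Sigma_1\Box\Sigma_2$ be their Cartesian product. Then $$\operatorname{bdim}(\Sigma_1\Box\Sigma_2)=\begin{cases}\operatorname{bdim}(\Sigma_1), & \text{if } \Sigma_2 \text{ is balanced},\\ \operatorname{bdim}(\Sigma_2), & \text{if } \Sigma_1 \text{ is balanced}.\end{cases}$$
   Context: A signed graph $\Sigma=(G,\sigma)$ is a graph $G=(V,E)$ with a function $\sigma:E\to\{+1,-1\}$. All graphs are finite, simple, connected and undirected unless otherwise mentioned. The sign of a cycle is the product of the signs of its edges; $\Sigma$ is balanced if it has no cycle of sign $-1$. Let $\Omega=\{ -1,0,1\}$, with $\Omega^k\subset\mathbb{R}^k$ carrying the standard inner product $\langle\cdot,\cdot\rangle$. A vector valued switching function ($k$-switching function) for $\Sigma$ is a map $\zeta:V\to\Omega^k$ with $\langle\zeta(u),\zeta(v)\rangle\neq 0$ for every edge $uv\in E$; the switched signed graph $\Sigma^\zeta=(G,\sigma^\zeta)$ has $\sigma^\zeta(uv)=\sigma(uv)\operatorname{sgn}(\langle\zeta(u),\zeta(v)\rangle)$. The balancing dimension $\operatorname{bdim}(\Sigma)$ is the least integer $k\ge 1$ for which there is a $k$-switching function $\zeta:V\to\Omega^k$ such that $\Sigma^\zeta$ is all-positive (every edge has sign $+1$). The Cartesian product $\Sigma_1\Box\Sigma_2$ is the Cartesian product $G_1\Box G_2$ of the underlying graphs, with signature $\sigma((u_i,v_j)(u_k,v_l))=\sigma_1(u_iu_k)$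 if $j=l$, and $=\sigma_2(v_jv_l)$ if $i=k$. -}

module Defs where

open import Data.Empty using (⊥-elim)
open import Data.Fin.Base using (Fin)
open import Data.Fin.Properties using (*↔×) renaming (_≟_ to _≟ᶠ_; all? to allᶠ?)
open import Data.Integer.Base as ℤ using (ℤ; 0ℤ; 1ℤ; -1ℤ; _◃_)
import Data.Integer.Properties as ℤ
open import Data.List.Base using (List; []; _∷_; length)
open import Data.List.Relation.Unary.Unique.Propositional using (Unique)
open import Data.Nat.Base as ℕ using (ℕ; zero; suc; _≤_; z≤n; s≤s)
import Data.Nat.Properties as ℕ
open import Data.Product.Base using (∃; _×_; _,_; proj₁; proj₂)
open import Data.Product.Function.NonDependent.Propositional using (_×-↔_)
open import Data.Sign.Base as Sign using (Sign)
import Data.Sign.Properties as Sign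
open import Data.Sum.Base using (_⊎_; inj₁; inj₂)
open import Data.Vec.Base as Vec using (Vec; []; _∷_)
open import Data.Vec.Membership.Propositional using (_∈_)
open import Data.Vec.Membership.Propositional.Properties using (∈-allFin⁺; ∈-allPairs⁺; ∈-map⁺)
import Data.Vec.Properties as Vec
open import Data.Vec.Relation.Unary.Any using (here; there)
open import Function.Base using (_∘_)
open import Function.Bundles using (_↔_; module Inverse)
open import Function.Construct.Composition using (_↔-∘_)
open import Function.Construct.Symmetry using (↔-sym)
open import Function.Properties.Inverse using (↔⇒↣)
open import Relation.Binary.Construct.Closure.ReflexiveTransitive using (Star; ε; _◅_)
open import Relation.Binary.Definitions using (DecidableEquality; Symmetric)
open import Relation.Binary.PropositionalEquality
  using (_≡_; _≢_; refl; sym; trans; cong; cong₂; subst; subst₂)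
open import Relation.Nullary.Decidable using (Dec; yes; no; map′; via-injection; _×-dec_; _⊎-dec_; ¬?)
open import Relation.Nullary.Negation using (¬_)
open import Relation.Unary using (Decidable)

------------------------------------------------------------------------
-- Signed graphs

-- A finite simple undirected graph.  `E u v` need not be a proposition;
-- only whether it is inhabited matters.

record Graph : Set₁ where
  field
    V        : Set
    order    : ℕ
    finite   : V ↔ Fin order
    E        : V → V → Set
    E?       : ∀ u v → Dec (E u v)
    E-sym    : Symmetric E
    E-irrefl : ∀ {v} → ¬ E v v

  _≟_ : DecidableEquality V
  _≟_ = via-injection (↔⇒↣ finite) _≟ᶠ_

  Walk : V → V → Set
  Walk = Star E

  vertices : ∀ {u v} → Walk u v → List V
  vertices {u} ε       = u ∷ []
  vertices {u} (e ◅ w) = u ∷ vertices w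

  Connected : Set
  Connected = V × (∀ u v → Walk u v)

  record Cycle : Set where
    field
      {start end} : V
      path        : Walk start end
      distinct    : Unique (vertices path)
      proper      : 3 ≤ length (vertices path)
      closing     : E end start

-- `σ-sym` says that the two orientations of an edge carry the same sign;
-- it also forces `σ` not to depend on the proof of adjacency
-- (see `σ-irrelevant`).

record SignedGraph : Set₁ where
  field
    graph : Graph

  open Graph graph public

  field
    σ     : ∀ {u v} → E u v → Sign
    σ-sym : ∀ {u v} (e : E u v) (e′ : E v u) → σ e ≡ σ e′

  σ-irrelevant : ∀ {u v} (e e′ : E u v) → σ e ≡ σ e′
  σ-irrelevant e e′ = trans (σ-sym e (E-sym e)) (σ-sym (E-sym e) e′)

  walkSign : ∀ {u v} → Walk u v → Sign
  walkSign ε       = Sign.+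
  walkSign (e ◅ w) = σ e Sign.* walkSign w

  cycleSign : Cycle → Sign
  cycleSign c = walkSign (Cycle.path c) Sign.* σ (Cycle.closing c)

  Balanced : Set
  Balanced = ¬ (∃ λ c → cycleSign c ≡ Sign.-)

  AllPositive : Set
  AllPositive = ∀ {u v} (e : E u v) → σ e ≡ Sign.+

------------------------------------------------------------------------
-- Cartesian products

infixr 7 _□_ _□ᴳ_

_□ᴳ_ : Graph → Graph → Graph
G₁ □ᴳ G₂ = record
  { V        = G₁.V × G₂.V
  ; order    = G₁.order ℕ.* G₂.order
  ; finite   = ↔-sym *↔× ↔-∘ (G₁.finite ×-↔ G₂.finite)
  ; E        = λ (u , v) (u′ , v′) → (G₁.E u u′ × v ≡ v′) ⊎ (u ≡ u′ × G₂.E v v′)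
  ; E?       = λ (u , v) (u′ , v′) →
                 (G₁.E? u u′ ×-dec (v G₂.≟ v′)) ⊎-dec ((u G₁.≟ u′) ×-dec G₂.E? v v′)
  ; E-sym    = λ { (inj₁ (e , p)) → inj₁ (G₁.E-sym e , sym p)
                 ; (inj₂ (p , e)) → inj₂ (sym p , G₂.E-sym e) }
  ; E-irrefl = λ { (inj₁ (e , _)) → G₁.E-irrefl e ; (inj₂ (_ , e)) → G₂.E-irrefl e }
  }
  where
  module G₁ = Graph G₁
  module G₂ = Graph G₂

_□_ : SignedGraph → SignedGraph → SignedGraph
Σ₁ □ Σ₂ = record
  { graph = Σ₁.graph □ᴳ Σ₂.graph
  ; σ     = λ { (inj₁ (e , _)) → Σ₁.σ e ; (inj₂ (_ , e)) → Σ₂.σ e }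
  ; σ-sym = λ { (inj₁ (e , _))    (inj₁ (e′ , _))   → Σ₁.σ-sym e e′
              ; (inj₁ (e , _))    (inj₂ (refl , _)) → ⊥-elim (Σ₁.E-irrefl e)
              ; (inj₂ (refl , _)) (inj₁ (e′ , _))   → ⊥-elim (Σ₁.E-irrefl e′)
              ; (inj₂ (_ , e))    (inj₂ (_ , e′))   → Σ₂.σ-sym e e′ }
  }
  where
  module Σ₁ = SignedGraph Σ₁
  module Σ₂ = SignedGraph Σ₂

------------------------------------------------------------------------
-- Vector valued switching

data Ω : Set where
  -1Ω 0Ω 1Ω : Ω

⟦_⟧ : Ω → ℤ
⟦ -1Ω ⟧ = -1ℤ
⟦ 0Ω  ⟧ = 0ℤ
⟦ 1Ω  ⟧ = 1ℤ

⟨_,_⟩ : ∀ {k} → Vec Ω k → Vec Ω k → ℤ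
⟨ []     , []     ⟩ = 0ℤ
⟨ x ∷ xs , y ∷ ys ⟩ = ⟦ x ⟧ ℤ.* ⟦ y ⟧ ℤ.+ ⟨ xs , ys ⟩

⟨⟩-comm : ∀ {k} (x y : Vec Ω k) → ⟨ x , y ⟩ ≡ ⟨ y , x ⟩
⟨⟩-comm []       []       = refl
⟨⟩-comm (x ∷ xs) (y ∷ ys) = cong₂ ℤ._+_ (ℤ.*-comm ⟦ x ⟧ ⟦ y ⟧) (⟨⟩-comm xs ys)

record SwitchingFunction (S : SignedGraph) (k : ℕ) : Set where
  open SignedGraph S
  field
    ζ       : V → Vec Ω k
    nonzero : ∀ {u v} → E u v → ⟨ ζ u , ζ v ⟩ ≢ 0ℤ

-- `ℤ.sign` sends 0 to `+`, but it is only applied to nonzero integers here.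

switch : ∀ {k} (S : SignedGraph) → SwitchingFunction S k → SignedGraph
switch S f = record
  { graph = graph
  ; σ     = λ {u} {v} e → σ e Sign.* ℤ.sign ⟨ ζ u , ζ v ⟩
  ; σ-sym = λ {u} {v} e e′ → cong₂ Sign._*_ (σ-sym e e′) (cong ℤ.sign (⟨⟩-comm (ζ u) (ζ v)))
  }
  where
  open SignedGraph S
  open SwitchingFunction f

PositivelySwitchable : SignedGraph → ℕ → Set
PositivelySwitchable S k =
  ∃ λ (f : SwitchingFunction S k) → SignedGraph.AllPositive (switch S f)

------------------------------------------------------------------------
-- Every signed graph is positively switchable in some dimension

module _ (S : SignedGraph) where
  open SignedGraph S

  private
    signΩ : Sign → Ω
    signΩ Sign.- = -1Ω
    signΩ Sign.+ = 1Ω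

    -- One coordinate for each ordered pair (a , b): if ab is an edge, it is
    -- 1 at a, σ(ab) at b and 0 elsewhere; otherwise it vanishes identically.
    coord : V → V × V → Ω
    coord u (a , b) with E? a b | u ≟ a | u ≟ b
    ... | no  _ | _     | _     = 0Ω
    ... | yes _ | yes _ | _     = 1Ω
    ... | yes e | no  _ | yes _ = signΩ (σ e)
    ... | yes _ | no  _ | no  _ = 0Ω

    1*signΩ : ∀ s → 1ℤ ℤ.* ⟦ signΩ s ⟧ ≡ s ◃ 1
    1*signΩ Sign.- = refl
    1*signΩ Sign.+ = refl

    signΩ*1 : ∀ s → ⟦ signΩ s ⟧ ℤ.* 1ℤ ≡ s ◃ 1
    signΩ*1 Sign.- = refl
    signΩ*1 Sign.+ = refl

    term : ∀ {u v} (e : E u v) p → ∃ λ m → ⟦ coord u p ⟧ ℤ.* ⟦ coord v p ⟧ ≡ σ e ◃ m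
    term {u} {v} e (a , b) with E? a b | u ≟ a | u ≟ b | v ≟ a | v ≟ b
    ... | no  _  | _        | _        | _        | _        = 0 , refl
    ... | yes _  | yes refl | _        | yes refl | _        = ⊥-elim (E-irrefl e)
    ... | yes e′ | yes refl | _        | no _     | yes refl =
      1 , trans (1*signΩ (σ e′)) (cong (_◃ 1) (σ-irrelevant e′ e))
    ... | yes _  | yes _    | _        | no _     | no _     = 0 , refl
    ... | yes e′ | no _     | yes refl | yes refl | _        =
      1 , trans (signΩ*1 (σ e′)) (cong (_◃ 1) (σ-sym e′ e))
    ... | yes _  | no _     | yes refl | no _     | yes refl = ⊥-elim (E-irrefl e)
    ... | yes e′ | no _     | yes _    | no _     | no _     = 0 , ℤ.*-zeroʳ ⟦ signΩ (σ e′) ⟧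
    ... | yes _  | no _     | no _     | _        | _        = 0 , refl

    term-uv : ∀ {u v} (e : E u v) → ⟦ coord u (u , v) ⟧ ℤ.* ⟦ coord v (u , v) ⟧ ≡ σ e ◃ 1
    term-uv {u} {v} e with E? u v | u ≟ u | u ≟ v | v ≟ u | v ≟ v
    ... | no ¬e  | _      | _ | _        | _     = ⊥-elim (¬e e)
    ... | yes _  | no u≢u | _ | _        | _     = ⊥-elim (u≢u refl)
    ... | yes _  | yes _  | _ | yes refl | _     = ⊥-elim (E-irrefl e)
    ... | yes _  | yes _  | _ | no _     | no v≢v = ⊥-elim (v≢v refl)
    ... | yes e′ | yes _  | _ | no _     | yes _ =
      trans (1*signΩ (σ e′)) (cong (_◃ 1) (σ-irrelevant e′ e))

    add : ∀ s {i j} m n → i ≡ s ◃ m → j ≡ s ◃ n → i ℤ.+ j ≡ s ◃ (m ℕ.+ n)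
    add s m n p q = trans (cong₂ ℤ._+_ p q) (sym (ℤ.◃-distrib-+ s m n))

    embed : ∀ {l} → Vec (V × V) l → V → Vec Ω l
    embed ps u = Vec.map (coord u) ps

    total : ∀ {u v l} (e : E u v) (ps : Vec (V × V) l) →
            ∃ λ m → ⟨ embed ps u , embed ps v ⟩ ≡ σ e ◃ m
    total e []       = 0 , refl
    total e (p ∷ ps) with term e p | total e ps
    ... | m , eq | n , eq′ = m ℕ.+ n , add (σ e) m n eq eq′

    total⁺ : ∀ {u v l} (e : E u v) {ps : Vec (V × V) l} → (u , v) ∈ ps →
             ∃ λ m → ⟨ embed ps u , embed ps v ⟩ ≡ σ e ◃ suc m
    total⁺ e {_ ∷ ps} (here refl) with total e ps
    ... | n , eq′ = n , add (σ e) 1 n (term-uv e) eq′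
    total⁺ e {p ∷ ps} (there uv∈ps) with term e p | total⁺ e uv∈ps
    ... | m , eq | n , eq′ =
      m ℕ.+ n , trans (add (σ e) m (suc n) eq eq′) (cong (σ e ◃_) (ℕ.+-suc m n))

    allV : Vec V order
    allV = Vec.map (Inverse.from finite) (Vec.allFin order)

    ∈-allV : ∀ v → v ∈ allV
    ∈-allV v = subst (_∈ allV) (Inverse.strictlyInverseʳ finite v)
                     (∈-map⁺ (Inverse.from finite) (∈-allFin⁺ (Inverse.to finite v)))

    ζ₀ : V → Vec Ω (suc (order ℕ.* order))
    ζ₀ u = 0Ω ∷ embed (Vec.allPairs allV allV) u

    ζ₀-edge : ∀ {u v} (e : E u v) → ∃ λ m → ⟨ ζ₀ u , ζ₀ v ⟩ ≡ σ e ◃ suc m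
    ζ₀-edge {u} {v} e with total⁺ e (∈-allPairs⁺ (∈-allV u) (∈-allV v))
    ... | m , eq = m , trans (ℤ.+-identityˡ _) eq

    ◃suc≢0 : ∀ s m → s ◃ suc m ≢ 0ℤ
    ◃suc≢0 Sign.- m ()
    ◃suc≢0 Sign.+ m ()

  switchable-somewhere : PositivelySwitchable S (suc (order ℕ.* order))
  switchable-somewhere =
    record { ζ       = ζ₀
           ; nonzero = λ e eq → let m , eq′ = ζ₀-edge e in ◃suc≢0 (σ e) m (trans (sym eq′) eq) }
    , λ e → let m , eq = ζ₀-edge e in
        trans (cong (λ i → σ e Sign.* ℤ.sign i) eq)
       (trans (cong (σ e Sign.*_) (ℤ.sign-◃ (σ e) (suc m))) (Sign.s*s≡+ (σ e)))

------------------------------------------------------------------------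
-- Positive switchability is decidable

private
  Searchable : Set → Set₁
  Searchable A = ∀ {P : A → Set} → Decidable P → Dec (∃ P)

  search-Ω : Searchable Ω
  search-Ω P? with P? -1Ω | P? 0Ω | P? 1Ω
  ... | yes p | _     | _     = yes (-1Ω , p)
  ... | no _  | yes p | _     = yes (0Ω , p)
  ... | no _  | no _  | yes p = yes (1Ω , p)
  ... | no ¬a | no ¬b | no ¬c = no λ { (-1Ω , p) → ¬a p ; (0Ω , p) → ¬b p ; (1Ω , p) → ¬c p }

  search-Vec : ∀ {A} → Searchable A → ∀ n → Searchable (Vec A n)
  search-Vec s zero    P? = map′ (λ p → [] , p) (λ { ([] , p) → p }) (P? [])
  search-Vec s (suc n) P? =
    map′ (λ { (x , xs , p) → x ∷ xs , p }) (λ { (x ∷ xs , p) → x , xs , p })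
         (s λ x → search-Vec s n λ xs → P? (x ∷ xs))

module _ (S : SignedGraph) where
  open SignedGraph S
  open Inverse finite using (to; from; strictlyInverseʳ)

  private
    all-V? : ∀ {P : V → Set} → Decidable P → Dec (∀ v → P v)
    all-V? {P} P? = map′ (λ f v → subst P (strictlyInverseʳ v) (f (to v))) (λ f i → f (from i))
                         (allᶠ? (P? ∘ from))

    Good : ∀ {k} → (V → Vec Ω k) → Set
    Good ζ = ∀ u v (e : E u v) →
             ⟨ ζ u , ζ v ⟩ ≢ 0ℤ × σ e Sign.* ℤ.sign ⟨ ζ u , ζ v ⟩ ≡ Sign.+

    Good? : ∀ {k} → Decidable (Good {k})
    Good? ζ = all-V? λ u → all-V? λ v → edge? u v
      where
      edge? : ∀ u v → Dec (∀ (e : E u v) → _)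
      edge? u v with E? u v
      ... | no ¬e = yes λ e → ⊥-elim (¬e e)
      ... | yes e = map′
        (λ (nz , eq) e′ → nz , subst (λ s → s Sign.* _ ≡ Sign.+) (σ-irrelevant e e′) eq)
        (λ f → f e)
        (¬? (⟨ ζ u , ζ v ⟩ ℤ.≟ 0ℤ) ×-dec ((σ e Sign.* ℤ.sign ⟨ ζ u , ζ v ⟩) Sign.≟ Sign.+))

    Good-resp : ∀ {k} {ζ ζ′ : V → Vec Ω k} → (∀ v → ζ v ≡ ζ′ v) → Good ζ → Good ζ′
    Good-resp eq g u v e =
      subst₂ (λ x y → ⟨ x , y ⟩ ≢ 0ℤ × σ e Sign.* ℤ.sign ⟨ x , y ⟩ ≡ Sign.+) (eq u) (eq v) (g u v e)

    tabulated : ∀ {k} (ζ : V → Vec Ω k) v →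
                ζ v ≡ Vec.lookup (Vec.tabulate (ζ ∘ from)) (to v)
    tabulated ζ v = sym (trans (Vec.lookup∘tabulate (ζ ∘ from) (to v)) (cong ζ (strictlyInverseʳ v)))

  positivelySwitchable? : Decidable (PositivelySwitchable S)
  positivelySwitchable? k = map′
    (λ (t , g) → record { ζ = Vec.lookup t ∘ to ; nonzero = λ e → proj₁ (g _ _ e) }
               , λ e → proj₂ (g _ _ e))
    (λ (f , pos) → let open SwitchingFunction f in
       Vec.tabulate (ζ ∘ from) , Good-resp (tabulated ζ) (λ u v e → nonzero e , pos e))
    (search-Vec (search-Vec search-Ω k) order (λ t → Good? (Vec.lookup t ∘ to)))

------------------------------------------------------------------------
-- Balancing dimension

IsLeast : (ℕ → Set) → ℕ → Set
IsLeast P m = P m × (∀ n → P n → m ≤ n)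

least : ∀ {P : ℕ → Set} → Decidable P → ∀ n → P n → ∃ (IsLeast P)
least P? n p with P? 0
least P? n       p | yes p₀ = 0 , p₀ , λ _ _ → z≤n
least P? zero    p | no ¬p₀ = ⊥-elim (¬p₀ p)
least P? (suc n) p | no ¬p₀ with least (P? ∘ suc) n p
... | m , pm , min = suc m , pm , λ { zero p₀ → ⊥-elim (¬p₀ p₀) ; (suc j) pj → s≤s (min j pj) }

balancingDimension : ∀ S → ∃ (IsLeast (λ k → 1 ≤ k × PositivelySwitchable S k))
balancingDimension S =
  least (λ k → (1 ℕ.≤? k) ×-dec positivelySwitchable? S k) _ (s≤s z≤n , switchable-somewhere S)

bdim : SignedGraph → ℕ
bdim S = proj₁ (balancingDimension S)

{-# OPTIONS --safe #-}

-- A balanced connected signed graph is switched to all-positive by a scalar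
-- potential θ (Harary), the sign of a walk to a fixed root.  If Σ₂ is balanced
-- with potential θ and ζ switches Σ₁, then (u , v) ↦ θ(v) ζ(u) switches Σ₁ □ Σ₂:
-- the signs θ(v) cancel on edges inside a copy of Σ₁, and on the others the
-- inner product is θ(v) θ(v′) ⟨ζ(u), ζ(u)⟩.  Only isolated vertices of Σ₁ can
-- have ζ(u) = 0, and there ζ may be changed freely.  Conversely Σ₁ embeds in
-- Σ₁ □ Σ₂ as a fibre, so a switching of the product restricts to one of Σ₁.

module Submission where

open import Defs
open import Data.Empty using (⊥-elim)
open import Data.Integer.Base as ℤ using (0ℤ)
import Data.Integer.Properties as ℤ
open import Data.List.Base using (length)
open import Data.List.Membership.Propositional using (_∈_)
import Data.List.Membership.DecPropositional as DecMembership
open import Data.List.Relation.Unary.All as All using (All; []; _∷_)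
open import Data.List.Relation.Unary.All.Properties using (¬Any⇒All¬)
open import Data.List.Relation.Unary.AllPairs using ([]; _∷_)
open import Data.List.Relation.Unary.Any using (here; there)
open import Data.List.Relation.Unary.Unique.Propositional using (Unique)
open import Data.Nat.Base using (ℕ; suc; _≤_; z≤n; s≤s)
open import Data.Nat.Properties using (≤-antisym)
open import Data.Product.Base using (∃; _×_; _,_; proj₁; proj₂; swap)
open import Data.Sign.Base as Sign using (Sign)
import Data.Sign.Properties as Sign
open import Data.Sum.Base using (_⊎_; inj₁; inj₂)
open import Data.Vec.Base as Vec using (Vec; []; _∷_)
open import Function.Base using (_∘_)
open import Relation.Binary.Construct.Closure.ReflexiveTransitive using (ε; _◅_; _◅◅_)
open import Relation.Binary.PropositionalEquality
  using (_≡_; _≢_; refl; sym; trans; cong; cong₂; module ≡-Reasoning)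
open import Relation.Nullary.Decidable using (yes; no)

-- Balance and potentials

s*t≡+⇒s≡t : ∀ s t → s Sign.* t ≡ Sign.+ → s ≡ t
s*t≡+⇒s≡t Sign.- Sign.- _ = refl
s*t≡+⇒s≡t Sign.+ Sign.+ _ = refl

≢-⇒≡+ : ∀ {s} → s ≢ Sign.- → s ≡ Sign.+
≢-⇒≡+ {Sign.-} s≢- = ⊥-elim (s≢- refl)
≢-⇒≡+ {Sign.+} _   = refl

module _ (S : SignedGraph) where
  open SignedGraph S
  open DecMembership _≟_ using (_∈?_)

  -- `σ` is the coboundary of `θ`: switching by the scalars `θ` turns every edge positive.
  Potential : (V → Sign) → Set
  Potential θ = ∀ {u v} (e : E u v) → σ e ≡ θ u Sign.* θ v

  walkSign-◅◅ : ∀ {u v w} (p : Walk u v) (q : Walk v w) →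
                walkSign (p ◅◅ q) ≡ walkSign p Sign.* walkSign q
  walkSign-◅◅ ε       q = refl
  walkSign-◅◅ (e ◅ p) q =
    trans (cong (σ e Sign.*_) (walkSign-◅◅ p q))
          (sym (Sign.*-assoc (σ e) (walkSign p) (walkSign q)))

  prefix : ∀ {u v x} (p : Walk u v) → x ∈ vertices p → Walk u x
  prefix ε       (here refl) = ε
  prefix (e ◅ p) (here refl) = ε
  prefix (e ◅ p) (there i)   = e ◅ prefix p i

  suffix : ∀ {u v x} (p : Walk u v) → x ∈ vertices p → Walk x v
  suffix ε       (here refl) = ε
  suffix (e ◅ p) (here refl) = e ◅ p
  suffix (e ◅ p) (there i)   = suffix p i

  walkSign-split : ∀ {u v x} (p : Walk u v) (i : x ∈ vertices p) →
                   walkSign p ≡ walkSign (prefix p i) Sign.* walkSign (suffix p i)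
  walkSign-split ε       (here refl) = refl
  walkSign-split (e ◅ p) (here refl) = refl
  walkSign-split (e ◅ p) (there i)   =
    trans (cong (σ e Sign.*_) (walkSign-split p i))
          (sym (Sign.*-assoc (σ e) (walkSign (prefix p i)) (walkSign (suffix p i))))

  All-prefix : ∀ {u v x} {P : V → Set} (p : Walk u v) (i : x ∈ vertices p) →
               All P (vertices p) → All P (vertices (prefix p i))
  All-prefix ε       (here refl) ps        = ps
  All-prefix (e ◅ p) (here refl) (px ∷ _)  = px ∷ []
  All-prefix (e ◅ p) (there i)   (px ∷ ps) = px ∷ All-prefix p i ps

  Unique-prefix : ∀ {u v x} (p : Walk u v) (i : x ∈ vertices p) →
                  Unique (vertices p) → Unique (vertices (prefix p i))
  Unique-prefix ε       (here refl) us       = us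
  Unique-prefix (e ◅ p) (here refl) _        = [] ∷ []
  Unique-prefix (e ◅ p) (there i)   (u∉ ∷ us) = All-prefix p i u∉ ∷ Unique-prefix p i us

  Unique-suffix : ∀ {u v x} (p : Walk u v) (i : x ∈ vertices p) →
                  Unique (vertices p) → Unique (vertices (suffix p i))
  Unique-suffix ε       (here refl) us       = us
  Unique-suffix (e ◅ p) (here refl) us       = us
  Unique-suffix (e ◅ p) (there i)   (_ ∷ us) = Unique-suffix p i us

  end∈vertices : ∀ {u v} (p : Walk u v) → v ∈ vertices p
  end∈vertices ε       = here refl
  end∈vertices (e ◅ p) = there (end∈vertices p)

  module _ (balanced : Balanced) where

    -- Paths with fewer than three vertices do not give a `Cycle`: a closing
    -- edge would be a loop, or run back along the only edge of the path.
    closedPath-positive : ∀ {u v} (p : Walk u v) → Unique (vertices p) →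
                          (e : E v u) → σ e Sign.* walkSign p ≡ Sign.+
    closedPath-positive ε           us e = ⊥-elim (E-irrefl e)
    closedPath-positive (e′ ◅ ε)    us e = begin
      σ e Sign.* (σ e′ Sign.* Sign.+) ≡⟨ cong (σ e Sign.*_) (Sign.*-identityʳ (σ e′)) ⟩
      σ e Sign.* σ e′                 ≡⟨ cong (Sign._* σ e′) (σ-sym e e′) ⟩
      σ e′ Sign.* σ e′                ≡⟨ Sign.s*s≡+ (σ e′) ⟩
      Sign.+                          ∎
      where open ≡-Reasoning
    closedPath-positive p@(_ ◅ _ ◅ q) us e =
      trans (Sign.*-comm (σ e) (walkSign p)) (≢-⇒≡+ λ negative → balanced (cycle , negative))
      where
      nonempty : ∀ {x y} (r : Walk x y) → 3 ≤ suc (suc (length (vertices r)))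
      nonempty ε       = s≤s (s≤s (s≤s z≤n))
      nonempty (_ ◅ _) = s≤s (s≤s (s≤s z≤n))
      cycle : Cycle
      cycle = record { path = p ; distinct = us ; proper = nonempty q ; closing = e }

    -- Loop erasure. If `u` already lies on `q`, then `e` followed by the prefix of `q` up to `u`
    -- closes a path, which has sign `+` by `closedPath-positive`; cutting it off leaves the sign
    -- unchanged.
    walk⇒path : ∀ {u v} (p : Walk u v) →
                ∃ λ (q : Walk u v) → Unique (vertices q) × walkSign q ≡ walkSign p
    walk⇒path ε = ε , [] ∷ [] , refl
    walk⇒path {u} (e ◅ p) with walk⇒path p
    ... | q , us , eq with u ∈? vertices q
    ...   | no  u∉q = e ◅ q , ¬Any⇒All¬ _ u∉q ∷ us , cong (σ e Sign.*_) eq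
    ...   | yes i   = suffix q i , Unique-suffix q i us , (begin
      walkSign (suffix q i)
        ≡⟨ cong (Sign._* walkSign (suffix q i))
                (closedPath-positive (prefix q i) (Unique-prefix q i us) e) ⟨
      (σ e Sign.* walkSign (prefix q i)) Sign.* walkSign (suffix q i)
        ≡⟨ Sign.*-assoc (σ e) (walkSign (prefix q i)) (walkSign (suffix q i)) ⟩
      σ e Sign.* (walkSign (prefix q i) Sign.* walkSign (suffix q i))
        ≡⟨ cong (σ e Sign.*_) (walkSign-split q i) ⟨
      σ e Sign.* walkSign q
        ≡⟨ cong (σ e Sign.*_) eq ⟩
      σ e Sign.* walkSign p ∎)
      where open ≡-Reasoning

    -- Loop erasure of a closed walk yields a path with equal ends and distinct vertices, which can
    -- only be `ε`.
    closedWalk-positive : ∀ {u} (p : Walk u u) → walkSign p ≡ Sign.+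
    closedWalk-positive p with walk⇒path p
    ... | ε     , _        , eq = sym eq
    ... | _ ◅ q , u∉q ∷ _ , _  = ⊥-elim (All.lookup u∉q (end∈vertices q) refl)

    -- The walk from the root `r` to `u`, then along `e` to `v` and back to `r`, is closed, hence
    -- positive; this determines `σ e` from the signs of the other two pieces.
    balanced⇒potential : Connected → ∃ Potential
    balanced⇒potential (r , walk) = θ , λ {u} {v} e →
      let p = walk r u ; q = walk v r in begin
      σ e                       ≡⟨ s*t≡+⇒s≡t (σ e) (walkSign p Sign.* θ v) (begin
          σ e Sign.* (walkSign p Sign.* θ v) ≡⟨ Sign.*-assoc (σ e) (walkSign p) (θ v) ⟨
          σ e Sign.* walkSign p Sign.* θ v   ≡⟨ cong (Sign._* θ v) (Sign.*-comm (σ e) (walkSign p)) ⟩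
          walkSign p Sign.* σ e Sign.* θ v   ≡⟨ Sign.*-assoc (walkSign p) (σ e) (θ v) ⟩
          walkSign p Sign.* (σ e Sign.* θ v) ≡⟨ walkSign-◅◅ p (e ◅ q) ⟨
          walkSign (p ◅◅ e ◅ q)              ≡⟨ closedWalk-positive (p ◅◅ e ◅ q) ⟩
          Sign.+                             ∎) ⟩
      walkSign p Sign.* θ v     ≡⟨ cong (Sign._* θ v) (to≡from u) ⟩
      θ u Sign.* θ v            ∎
      where
      open ≡-Reasoning
      θ : V → Sign
      θ v = walkSign (walk v r)
      -- The chosen walks between `r` and `u` need not be reverses of each other, but together they
      -- form a closed walk.
      to≡from : ∀ u → walkSign (walk r u) ≡ θ u
      to≡from u = s*t≡+⇒s≡t _ _
        (trans (sym (walkSign-◅◅ (walk r u) (walk u r)))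
               (closedWalk-positive (walk r u ◅◅ walk u r)))

-- Signed vectors

-- The second alternative expresses `x = 0` as orthogonality to every vector, the form that
-- contradicts `nonzero` on an edge. Each nonzero entry adds 1 to the norm, and `null x` covers a
-- vanishing tail.
positive⊎null : ∀ {k} (x : Vec Ω k) →
                (∃ λ n → ⟨ x , x ⟩ ≡ ℤ.+ suc n) ⊎ (∀ y → ⟨ x , y ⟩ ≡ 0ℤ)
positive⊎null []       = inj₂ λ { [] → refl }
positive⊎null (a ∷ x) with a | positive⊎null x
... | -1Ω | inj₁ (n , eq) = inj₁ (suc n , cong ℤ.suc eq)
... | -1Ω | inj₂ null     = inj₁ (0 , cong ℤ.suc (null x))
... | 0Ω  | inj₁ (n , eq) = inj₁ (n , trans (ℤ.+-identityˡ _) eq)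
... | 0Ω  | inj₂ null     = inj₂ λ { (_ ∷ y) → trans (ℤ.+-identityˡ _) (null y) }
... | 1Ω  | inj₁ (n , eq) = inj₁ (suc n , cong ℤ.suc eq)
... | 1Ω  | inj₂ null     = inj₁ (0 , cong ℤ.suc (null x))

-- The leading entry contributes 1 whatever the tail is; in dimension 0 the norm would be 0.
ones-positive : ∀ k → ∃ λ n → ⟨ Vec.replicate (suc k) 1Ω , Vec.replicate (suc k) 1Ω ⟩ ≡ ℤ.+ suc n
ones-positive k with positive⊎null (Vec.replicate k 1Ω)
... | inj₁ (n , eq) = suc n , cong ℤ.suc eq
... | inj₂ null     = 0 , cong ℤ.suc (null _)

-Ω_ : Ω → Ω
-Ω -1Ω = 1Ω
-Ω 0Ω  = 0Ω
-Ω 1Ω  = -1Ω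

⟦-Ω⟧ : ∀ a → ⟦ -Ω a ⟧ ≡ ℤ.- ⟦ a ⟧
⟦-Ω⟧ -1Ω = refl
⟦-Ω⟧ 0Ω  = refl
⟦-Ω⟧ 1Ω  = refl

infixr 8 _•_

_•_ : ∀ {k} → Sign → Vec Ω k → Vec Ω k
Sign.+ • x = x
Sign.- • x = Vec.map -Ω_ x

⟨⟩-negˡ : ∀ {k} (x y : Vec Ω k) → ⟨ Sign.- • x , y ⟩ ≡ ℤ.- ⟨ x , y ⟩
⟨⟩-negˡ []      []      = refl
⟨⟩-negˡ (a ∷ x) (b ∷ y) = begin
  ⟦ -Ω a ⟧ ℤ.* ⟦ b ⟧ ℤ.+ ⟨ Sign.- • x , y ⟩
    ≡⟨ cong₂ (λ i j → i ℤ.* ⟦ b ⟧ ℤ.+ j) (⟦-Ω⟧ a) (⟨⟩-negˡ x y) ⟩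
  (ℤ.- ⟦ a ⟧) ℤ.* ⟦ b ⟧ ℤ.+ ℤ.- ⟨ x , y ⟩
    ≡⟨ cong (ℤ._+ ℤ.- ⟨ x , y ⟩) (sym (ℤ.neg-distribˡ-* ⟦ a ⟧ ⟦ b ⟧)) ⟩
  ℤ.- (⟦ a ⟧ ℤ.* ⟦ b ⟧) ℤ.+ ℤ.- ⟨ x , y ⟩
    ≡⟨ sym (ℤ.neg-distrib-+ (⟦ a ⟧ ℤ.* ⟦ b ⟧) ⟨ x , y ⟩) ⟩
  ℤ.- ⟨ a ∷ x , b ∷ y ⟩ ∎
  where open ≡-Reasoning

⟨⟩-negʳ : ∀ {k} (x y : Vec Ω k) → ⟨ x , Sign.- • y ⟩ ≡ ℤ.- ⟨ x , y ⟩
⟨⟩-negʳ x y = begin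
  ⟨ x , Sign.- • y ⟩ ≡⟨ ⟨⟩-comm x (Sign.- • y) ⟩
  ⟨ Sign.- • y , x ⟩ ≡⟨ ⟨⟩-negˡ y x ⟩
  ℤ.- ⟨ y , x ⟩      ≡⟨ cong ℤ.-_ (⟨⟩-comm y x) ⟩
  ℤ.- ⟨ x , y ⟩      ∎
  where open ≡-Reasoning

⟨⟩-cancel-• : ∀ {k} s (x y : Vec Ω k) → ⟨ s • x , s • y ⟩ ≡ ⟨ x , y ⟩
⟨⟩-cancel-• Sign.+ x y = refl
⟨⟩-cancel-• Sign.- x y =
  trans (⟨⟩-negˡ x (Sign.- • y)) (trans (cong ℤ.-_ (⟨⟩-negʳ x y)) (ℤ.neg-involutive ⟨ x , y ⟩))

⟨⟩-•-self : ∀ {k} s t {x : Vec Ω k} {n} → ⟨ x , x ⟩ ≡ ℤ.+ suc n →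
            ⟨ s • x , t • x ⟩ ≡ s Sign.* t ℤ.◃ suc n
⟨⟩-•-self Sign.+ Sign.+     eq = eq
⟨⟩-•-self Sign.+ Sign.- {x} eq = trans (⟨⟩-negʳ x x) (cong ℤ.-_ eq)
⟨⟩-•-self Sign.- Sign.+ {x} eq = trans (⟨⟩-negˡ x x) (cong ℤ.-_ eq)
⟨⟩-•-self Sign.- Sign.- {x} eq = trans (⟨⟩-cancel-• Sign.- x x) eq

-- Transport of switching functions

record Hom (S T : SignedGraph) : Set where
  private
    module S = SignedGraph S
    module T = SignedGraph T
  field
    map   : S.V → T.V
    map-E : ∀ {u v} → S.E u v → T.E (map u) (map v)
    map-σ : ∀ {u v} (e : S.E u v) → T.σ (map-E e) ≡ S.σ e

-- Both conditions on a switching function concern edges only, so they survive composition with a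
-- map that preserves edges and their signs.
pullback : ∀ {S T} → Hom S T → ∀ {k} → PositivelySwitchable T k → PositivelySwitchable S k
pullback h (f , pos) =
  record { ζ = ζ ∘ map ; nonzero = nonzero ∘ map-E } ,
  λ e → trans (cong (Sign._* _) (sym (map-σ e))) (pos (map-E e))
  where
  open Hom h
  open SwitchingFunction f

fibre : ∀ {Σ₁ Σ₂} → SignedGraph.V Σ₂ → Hom Σ₁ (Σ₁ □ Σ₂)
fibre v = record { map = _, v ; map-E = λ e → inj₁ (e , refl) ; map-σ = λ _ → refl }

□-swap : ∀ {Σ₁ Σ₂} → Hom (Σ₁ □ Σ₂) (Σ₂ □ Σ₁)
□-swap = record
  { map   = swap
  ; map-E = λ { (inj₁ (e , p)) → inj₂ (p , e) ; (inj₂ (p , e)) → inj₁ (e , p) }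
  ; map-σ = λ { (inj₁ _) → refl ; (inj₂ _) → refl }
  }

module _ {S : SignedGraph} {k : ℕ} (f : SwitchingFunction S (suc k)) where
  open SignedGraph S
  open SwitchingFunction f

  -- `ζ` may vanish at an isolated vertex, for instance in a one-vertex graph; the all-ones vector
  -- then stands in, so that the norm is positive everywhere.
  ζ⁺ : V → Vec Ω (suc k)
  ζ⁺ u with positive⊎null (ζ u)
  ... | inj₁ _ = ζ u
  ... | inj₂ _ = Vec.replicate (suc k) 1Ω

  ζ⁺-positive : ∀ u → ∃ λ n → ⟨ ζ⁺ u , ζ⁺ u ⟩ ≡ ℤ.+ suc n
  ζ⁺-positive u with positive⊎null (ζ u)
  ... | inj₁ pos = pos
  ... | inj₂ _   = ones-positive k

  -- A null vector at an end of an edge would make the inner product across it 0.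
  ζ⁺-edge : ∀ {u v} → E u v → ζ⁺ u ≡ ζ u
  ζ⁺-edge {u} {v} e with positive⊎null (ζ u)
  ... | inj₁ _    = refl
  ... | inj₂ null = ⊥-elim (nonzero e (null (ζ v)))

□-switchable : ∀ {Σ₁ Σ₂ k} → ∃ (Potential Σ₂) →
               PositivelySwitchable Σ₁ (suc k) → PositivelySwitchable (Σ₁ □ Σ₂) (suc k)
□-switchable {Σ₁} {Σ₂} {k} (θ , potential) (f , pos) =
  record { ζ = ξ ; nonzero = nonzero-ξ } , positive
  where
  module Σ₁ = SignedGraph Σ₁
  module Σ₂ = SignedGraph Σ₂
  module P  = SignedGraph (Σ₁ □ Σ₂)
  open SwitchingFunction f

  ξ : P.V → Vec Ω (suc k)
  ξ (u , v) = θ v • ζ⁺ f u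

  ξ-edge₁ : ∀ {u u′} v → Σ₁.E u u′ → ⟨ ξ (u , v) , ξ (u′ , v) ⟩ ≡ ⟨ ζ u , ζ u′ ⟩
  ξ-edge₁ v e = trans (⟨⟩-cancel-• (θ v) _ _)
                      (cong₂ ⟨_,_⟩ (ζ⁺-edge f e) (ζ⁺-edge f (Σ₁.E-sym e)))

  -- Both ends carry multiples of the vector `ζ⁺ f u` of positive norm, and `θ v` times `θ v′` is
  -- the sign of `e`. The value `n` is left open, as only the sign and nonvanishing matter.
  ξ-edge₂ : ∀ {v v′} u (e : Σ₂.E v v′) → ∃ λ n → ⟨ ξ (u , v) , ξ (u , v′) ⟩ ≡ Σ₂.σ e ℤ.◃ suc n
  ξ-edge₂ {v} {v′} u e with ζ⁺-positive f u
  ... | n , eq = n , trans (⟨⟩-•-self (θ v) (θ v′) eq) (cong (ℤ._◃ suc n) (sym (potential e)))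

  ◃suc≢0 : ∀ s {n} → s ℤ.◃ suc n ≢ 0ℤ
  ◃suc≢0 Sign.- ()
  ◃suc≢0 Sign.+ ()

  nonzero-ξ : ∀ {x y} → P.E x y → ⟨ ξ x , ξ y ⟩ ≢ 0ℤ
  nonzero-ξ (inj₁ (e , refl)) eq = nonzero e (trans (sym (ξ-edge₁ _ e)) eq)
  nonzero-ξ (inj₂ (refl , e)) eq = ◃suc≢0 (Σ₂.σ e) (trans (sym (proj₂ (ξ-edge₂ _ e))) eq)

  positive : ∀ {x y} (e : P.E x y) → P.σ e Sign.* ℤ.sign ⟨ ξ x , ξ y ⟩ ≡ Sign.+
  positive (inj₁ (e , refl)) =
    trans (cong (λ i → Σ₁.σ e Sign.* ℤ.sign i) (ξ-edge₁ _ e)) (pos e)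
  positive (inj₂ (refl , e)) with ξ-edge₂ _ e
  ... | n , eq =
    trans (cong (λ i → Σ₂.σ e Sign.* ℤ.sign i) eq)
   (trans (cong (Σ₂.σ e Sign.*_) (ℤ.sign-◃ (Σ₂.σ e) (suc n))) (Sign.s*s≡+ (Σ₂.σ e)))

-- Balancing dimension of products

IsLeast-mono : ∀ {P Q : ℕ → Set} {m n} → (∀ k → Q k → P k) → IsLeast P m → IsLeast Q n → m ≤ n
IsLeast-mono Q⇒P (_ , least) (qn , _) = least _ (Q⇒P _ qn)

-- The constraint `1 ≤ k` in `bdim` excludes dimension 0, so switchings need to be transported only
-- in dimensions `suc k`, where the all-ones vector is nonzero.
bdim-mono : ∀ S T → (∀ {k} → PositivelySwitchable T (suc k) → PositivelySwitchable S (suc k)) →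
            bdim S ≤ bdim T
bdim-mono S T g = IsLeast-mono (λ { (suc k) (1≤k , switchable) → 1≤k , g switchable })
  (proj₂ (balancingDimension S)) (proj₂ (balancingDimension T))

bdim-cong : ∀ S T → (∀ {k} → PositivelySwitchable S (suc k) → PositivelySwitchable T (suc k)) →
            (∀ {k} → PositivelySwitchable T (suc k) → PositivelySwitchable S (suc k)) →
            bdim S ≡ bdim T
bdim-cong S T f g = ≤-antisym (bdim-mono S T g) (bdim-mono T S f)

bdim-□-balancedʳ : ∀ Σ₁ Σ₂ → SignedGraph.Connected Σ₂ → SignedGraph.Balanced Σ₂ →
                   bdim (Σ₁ □ Σ₂) ≡ bdim Σ₁
bdim-□-balancedʳ Σ₁ Σ₂ connected balanced =
  -- Connectedness enters twice: its base vertex selects the fibre, and its walks define the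
  -- potential.
  bdim-cong (Σ₁ □ Σ₂) Σ₁ (pullback (fibre {Σ₁} {Σ₂} (proj₁ connected)))
    (□-switchable {Σ₁} {Σ₂} (balanced⇒potential Σ₂ balanced connected))

-- Reduces the case of balanced `Σ₁` to that of balanced `Σ₂`; exchanging the factors is an
-- involution, so `□-swap` gives both inequalities.
bdim-□-comm : ∀ Σ₁ Σ₂ → bdim (Σ₁ □ Σ₂) ≡ bdim (Σ₂ □ Σ₁)
bdim-□-comm Σ₁ Σ₂ = bdim-cong (Σ₁ □ Σ₂) (Σ₂ □ Σ₁)
  (pullback (□-swap {Σ₂} {Σ₁})) (pullback (□-swap {Σ₁} {Σ₂}))

theorem2p2 : (Σ₁ Σ₂ : SignedGraph) →
    SignedGraph.Connected Σ₁ →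
    SignedGraph.Connected Σ₂ →
    (SignedGraph.Balanced Σ₂ → bdim (Σ₁ □ Σ₂) ≡ bdim Σ₁) ×
    (SignedGraph.Balanced Σ₁ → bdim (Σ₁ □ Σ₂) ≡ bdim Σ₂)
theorem2p2 Σ₁ Σ₂ connected₁ connected₂ =
  bdim-□-balancedʳ Σ₁ Σ₂ connected₂ ,
  λ balanced₁ → trans (bdim-□-comm Σ₁ Σ₂) (bdim-□-balancedʳ Σ₂ Σ₁ connected₁ balanced₁)
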